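{- Let $G$ be a connected graph with $n\geq 3$ vertices. If $G$ has $k>0$ basis forced vertices, then $|E(G)|\leq \frac{n(n-1)}{2}-2k$.
   Context: All graphs are finite and simple. For vertices $u,v$ of a connected graph $G$, $d(u,v)$ is the length of a shortest $u$–$v$ path. A set $R\subseteq V(G)$ is a resolving set if for all distinct $x,y\in V(G)$ there is $r\in R$ with $d(r,x)\neq d(r,y)$. The metric dimension $\dim(G)$ is the minimum cardinality of a resolving set, and a resolving set of cardinality $\dim(G)$ is a metric basis. A vertex is a basis forced vertex if it belongs to every metric basis of $G$. -}

module Defs where

open import Data.Fin.Base using (Fin)
open import Data.Fin.Properties using (_<?_)
open import Data.Fin.Subset using (Subset; _∈_; ∣_∣)
open import Data.List.Base using (List; []; _∷_; length; filter; allFin; cartesianProduct)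
open import Data.List.Relation.Unary.Unique.Propositional using (Unique)
open import Data.Nat.Base using (ℕ; zero; suc; _≤_)
open import Data.Product.Base using (∃-syntax; Σ-syntax; _×_; _,_)
open import Function.Bundles using (_⇔_)
open import Relation.Binary.Definitions using (Decidable; Symmetric; Irreflexive)
open import Relation.Binary.PropositionalEquality.Core using (_≡_; _≢_)
open import Relation.Nullary.Decidable.Core using (_×-dec_)

record Graph (n : ℕ) : Set₁ where
  infix 4 _~_ _~?_
  field
    _~_    : Fin n → Fin n → Set
    _~?_   : Decidable _~_
    sym    : Symmetric _~_
    irrefl : Irreflexive _≡_ _~_

module _ {n : ℕ} (G : Graph n) where
  open Graph G

  -- Each edge {i , j} is listed once, as the ordered pair with i < j.
  edges : List (Fin n × Fin n)
  edges = filter (λ (i , j) → (i <? j) ×-dec (i ~? j))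
                 (cartesianProduct (allFin n) (allFin n))

  ∣E∣ : ℕ
  ∣E∣ = length edges

  data Walk : Fin n → Fin n → Set where
    []   : ∀ {u} → Walk u u
    step : ∀ {u v w} → u ~ v → Walk v w → Walk u w

  walkLength : ∀ {u v} → Walk u v → ℕ
  walkLength []         = zero
  walkLength (step _ p) = suc (walkLength p)

  vertices : ∀ {u v} → Walk u v → List (Fin n)
  vertices {u} []         = u ∷ []
  vertices {u} (step _ p) = u ∷ vertices p

  Path : Fin n → Fin n → Set
  Path u v = Σ[ p ∈ Walk u v ] Unique (vertices p)

  pathLength : ∀ {u v} → Path u v → ℕ
  pathLength (p , _) = walkLength p

  Connected : Set
  Connected = ∀ u v → Path u v

  -- The relation d(u,v) = d; it is functional, and total when G is
  -- connected.
  IsDistance : Fin n → Fin n → ℕ → Set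
  IsDistance u v d =
    (Σ[ p ∈ Path u v ] pathLength p ≡ d) × (∀ (p : Path u v) → d ≤ pathLength p)

  -- d(r,x) ≠ d(r,y)
  Resolves : Fin n → Fin n → Fin n → Set
  Resolves r x y =
    ∃[ a ] ∃[ b ] IsDistance r x a × IsDistance r y b × a ≢ b

  IsResolvingSet : Subset n → Set
  IsResolvingSet R = ∀ x y → x ≢ y → ∃[ r ] r ∈ R × Resolves r x y

  -- The relation dim(G) = m.
  IsMetricDimension : ℕ → Set
  IsMetricDimension m =
    (∃[ R ] IsResolvingSet R × ∣ R ∣ ≡ m) × (∀ R → IsResolvingSet R → m ≤ ∣ R ∣)

  IsMetricBasis : Subset n → Set
  IsMetricBasis R = IsResolvingSet R × IsMetricDimension ∣ R ∣

  IsBasisForced : Fin n → Set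
  IsBasisForced v = ∀ R → IsMetricBasis R → v ∈ R

  -- The number of basis forced vertices is exactly k.
  HasBasisForcedVertices : ℕ → Set
  HasBasisForcedVertices k =
    Σ[ F ∈ Subset n ] (∀ v → v ∈ F ⇔ IsBasisForced v) × ∣ F ∣ ≡ k

{-# OPTIONS --safe #-}

-- Fix a metric basis R and a basis forced vertex v (so v ∈ R).  Replacing v
-- in R by any other vertex u gives a set without v of size at most |R|, which
-- therefore does not resolve G.  Comparing the unresolved pairs for a few
-- choices of u shows that v has at least two non-neighbours outside R.  As all
-- forced vertices lie in R, these non-edges are distinct for different forced
-- vertices, so G misses at least 2k edges.

module Submission where

open import Defs
open import Data.Empty using (⊥)
open import Data.Fin using (Fin; zero; suc; combine) renaming (_<_ to _<ᶠ_)
open import Data.Fin.Properties using (_≟_; any?; all?; combine-injective; injective⇒≤) renaming (<-asym to <ᶠ-asym)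
open import Data.Fin.Subset using (Subset; inside; outside; _∈_; _∉_; _∪_; _-_; ⁅_⁆; ⊤; ∣_∣)
open import Data.Fin.Subset.Properties using (_∈?_; ∈⊤; anySubset?; ∣⁅x⁆∣≡1; x∈⁅x⁆; x∈⁅y⁆⇒x≡y; p⊆p∪q; q⊆p∪q; x∈p∪q⁻; x∈p∧x≢y⇒x∈p-y; x∈p⇒∣p-x∣<∣p∣)
open import Data.List.Base using (List; []; _∷_; _++_; length; map; lookup; allFin; cartesianProduct)
open import Data.List.Properties using (length-++; length-map; length-tabulate)
open import Data.List.Membership.Propositional using () renaming (_∈_ to _∈ˡ_)
open import Data.List.Membership.Propositional.Properties using (∈-map⁻; ∈-++⁻; ∈-filter⁻; ∈-lookup)
open import Data.List.Relation.Unary.All as All using (All; []; _∷_)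
open import Data.List.Relation.Unary.All.Properties using (¬Any⇒All¬)
open import Data.List.Relation.Unary.Any using (here; there)
open import Data.List.Relation.Unary.AllPairs using ([]; _∷_)
open import Data.List.Relation.Unary.Unique.Propositional using (Unique)
import Data.List.Relation.Unary.Unique.Propositional.Properties as Unique
open import Data.Nat using (ℕ; zero; suc; _+_; _*_; _∸_; _≤_; _<_; _≥_; _>_; z≤n; s≤s)
open import Data.Nat.DivMod using (_/_; m*n/n≡m; /-monoˡ-≤)
open import Data.Nat.Induction using (<-wellFounded)
open import Data.Nat.Properties using (≤-refl; ≤-reflexive; ≤-trans; ≤-antisym; ≮⇒≥; m≤n⇒m≤1+n; n≤0⇒n≡0; +-identityʳ; +-comm; +-suc; +-monoʳ-≤; *-comm; *-suc; +-cancelˡ-≤; module ≤-Reasoning) renaming (_≟_ to _≟ⁿ_; _<?_ to _<ⁿ?_)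
open import Data.Product using (Σ-syntax; ∃; ∃-syntax; _×_; _,_; proj₁; proj₂; swap)
open import Data.Sum using (_⊎_; inj₁; inj₂; [_,_]′)
open import Data.Vec using ([]; _∷_; here; there)
open import Function using (_∘_; Equivalence)
open import Induction.WellFounded using (Acc; acc)
open import Level using (Level)
open import Relation.Binary.PropositionalEquality using (_≡_; _≢_; refl; sym; trans; cong; cong₂; subst; ≢-sym)
open import Relation.Nullary using (¬_; yes; no; contradiction; ¬?; _×-dec_; _→-dec_)
open import Relation.Nullary.Decidable using (map′; decidable-stable)
open import Relation.Unary using (Pred; Decidable)

private
  variable
    ℓ : Level
    n : ℕ

-- Least witnesses, and finite subsets as lists.

least : {P : Pred ℕ ℓ} → Decidable P → ∀ m → P m →
        ∃[ k ] P k × (∀ j → P j → k ≤ j)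
least P? zero p = zero , p , λ _ _ → z≤n
least P? (suc m) p with P? zero
... | yes p₀ = zero , p₀ , λ _ _ → z≤n
... | no ¬p₀ with k , pk , k≤ ← least (P? ∘ suc) m p =
  suc k , pk , λ where
    zero    p₀ → contradiction p₀ ¬p₀
    (suc j) pj → s≤s (k≤ j pj)

∣p∪q∣≤∣p∣+∣q∣ : (p q : Subset n) → ∣ p ∪ q ∣ ≤ ∣ p ∣ + ∣ q ∣
∣p∪q∣≤∣p∣+∣q∣ []            []            = z≤n
∣p∪q∣≤∣p∣+∣q∣ (outside ∷ p) (outside ∷ q) = ∣p∪q∣≤∣p∣+∣q∣ p q
∣p∪q∣≤∣p∣+∣q∣ (outside ∷ p) (inside  ∷ q) =
  ≤-trans (s≤s (∣p∪q∣≤∣p∣+∣q∣ p q)) (≤-reflexive (sym (+-suc _ _)))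
∣p∪q∣≤∣p∣+∣q∣ (inside  ∷ p) (outside ∷ q) = s≤s (∣p∪q∣≤∣p∣+∣q∣ p q)
∣p∪q∣≤∣p∣+∣q∣ (inside  ∷ p) (inside  ∷ q) =
  s≤s (≤-trans (∣p∪q∣≤∣p∣+∣q∣ p q) (+-monoʳ-≤ ∣ p ∣ (m≤n⇒m≤1+n ≤-refl)))

elements : Subset n → List (Fin n)
elements []            = []
elements (inside  ∷ p) = zero ∷ map suc (elements p)
elements (outside ∷ p) = map suc (elements p)

length-elements : (p : Subset n) → length (elements p) ≡ ∣ p ∣
length-elements []            = refl
length-elements (inside  ∷ p) =
  cong suc (trans (length-map suc (elements p)) (length-elements p))
length-elements (outside ∷ p) = trans (length-map suc (elements p)) (length-elements p)

elements-unique : (p : Subset n) → Unique (elements p)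
elements-unique []            = []
elements-unique (inside  ∷ p) =
  All.tabulate (λ i∈ → λ where refl → 0∉ (∈-map⁻ suc i∈))
    ∷ Unique.map⁺ (λ where refl → refl) (elements-unique p)
  where
  0∉ : ¬ (∃[ i ] i ∈ˡ elements p × zero ≡ suc i)
  0∉ (_ , _ , ())
elements-unique (outside ∷ p) = Unique.map⁺ (λ where refl → refl) (elements-unique p)

∈-elements⁻ : (p : Subset n) {i : Fin n} → i ∈ˡ elements p → i ∈ p
∈-elements⁻ (inside ∷ p) (here refl) = here
∈-elements⁻ (inside ∷ p) (there i∈) with _ , j∈ , refl ← ∈-map⁻ suc i∈ =
  there (∈-elements⁻ p j∈)
∈-elements⁻ (outside ∷ p) i∈ with _ , j∈ , refl ← ∈-map⁻ suc i∈ =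
  there (∈-elements⁻ p j∈)

lookup-injective : ∀ {a} {A : Set a} {xs : List A} → Unique xs →
                   ∀ i j → lookup xs i ≡ lookup xs j → i ≡ j
lookup-injective (_  ∷ _)  zero    zero    _  = refl
lookup-injective (x∉ ∷ _)  zero    (suc j) eq = contradiction eq (All.lookup x∉ (∈-lookup j))
lookup-injective (x∉ ∷ _)  (suc i) zero    eq = contradiction (sym eq) (All.lookup x∉ (∈-lookup i))
lookup-injective (_  ∷ xs) (suc i) (suc j) eq = cong suc (lookup-injective xs i j eq)

-- Counting ordered pairs of vertices.

unique-pairs-length : {xs : List (Fin n × Fin n)} → Unique xs → length xs ≤ n * n
unique-pairs-length {n} {xs} uniq = injective⇒≤ {f = code} injective
  where
  code : Fin (length xs) → Fin (n * n)
  code i = let (a , b) = lookup xs i in combine a b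

  injective : ∀ {i j} → code i ≡ code j → i ≡ j
  injective {i} {j} eq with eq₁ , eq₂ ← combine-injective _ _ _ _ eq =
    lookup-injective uniq i j (cong₂ _,_ eq₁ eq₂)

-- The pairs, their reversals and the diagonal are pairwise disjoint.
asymmetric-pairs-length : {Q : Fin n → Fin n → Set ℓ} → (∀ i j → Q i j → ¬ Q j i) →
  (xs : List (Fin n × Fin n)) → Unique xs → (∀ {i j} → (i , j) ∈ˡ xs → Q i j) →
  length xs + length xs + n ≤ n * n
asymmetric-pairs-length {n} {Q = Q} asym xs uniq all =
  subst (_≤ n * n) length-all (unique-pairs-length unique-all)
  where
  diagonal = map (λ i → i , i) (allFin n)

  unique-all : Unique ((xs ++ map swap xs) ++ diagonal)
  unique-all = Unique.++⁺
    (Unique.++⁺ uniq (Unique.map⁺ (cong swap) uniq) disjoint-swap)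
    (Unique.map⁺ (cong proj₁) (Unique.allFin⁺ n))
    disjoint-diagonal
    where
    disjoint-swap : ∀ {v} → ¬ (v ∈ˡ xs × v ∈ˡ map swap xs)
    disjoint-swap (p∈ , q∈) with _ , r∈ , refl ← ∈-map⁻ swap q∈ =
      asym _ _ (all p∈) (all r∈)

    disjoint-diagonal : ∀ {v} → ¬ (v ∈ˡ xs ++ map swap xs × v ∈ˡ diagonal)
    disjoint-diagonal (p∈ , q∈)
      with _ , _ , refl ← ∈-map⁻ _ q∈
      with ∈-++⁻ xs p∈
    ... | inj₁ p∈₁ = asym _ _ (all p∈₁) (all p∈₁)
    ... | inj₂ p∈₂ with _ , r∈ , refl ← ∈-map⁻ swap p∈₂ = asym _ _ (all r∈) (all r∈)

  length-all : length ((xs ++ map swap xs) ++ diagonal) ≡ length xs + length xs + n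
  length-all = trans (length-++ (xs ++ map swap xs))
    (cong₂ _+_ (trans (length-++ xs) (cong (length xs +_) (length-map swap xs)))
               (trans (length-map _ (allFin n)) (length-tabulate {n = n} (λ i → i))))

-- Walks, paths and distance.

module _ (G : Graph n) where
  open Graph G renaming (sym to ~-sym; irrefl to ~-irrefl)
  open import Data.List.Membership.DecPropositional (_≟_ {n}) using () renaming (_∈?_ to _∈ˡ?_)

  WalkOfLength : Fin n → Fin n → ℕ → Set
  WalkOfLength u v k = Σ[ p ∈ Walk G u v ] walkLength G p ≡ k

  -- Fixing the length turns the existence of a walk into a finite search over its first step, so
  -- `least` can find a minimum length.
  walkOfLength? : ∀ u v → Decidable (WalkOfLength u v)
  walkOfLength? u v zero =
    map′ (λ where refl → [] , refl) (λ where ([] , _) → refl) (u ≟ v)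
  walkOfLength? u v (suc k) =
    map′ (λ (_ , e , p , eq) → step e p , cong suc eq)
         (λ where (step e p , refl) → _ , e , p , refl)
         (any? λ w → (u ~? w) ×-dec walkOfLength? w v k)

  suffixFrom : ∀ {u w v} (p : Walk G w v) → Unique (vertices G p) → u ∈ˡ vertices G p →
               Σ[ q ∈ Path G u v ] pathLength G q ≤ walkLength G p
  suffixFrom []         uniq       (here refl) = ([] , uniq) , ≤-refl
  suffixFrom (step e p) uniq       (here refl) = (step e p , uniq) , ≤-refl
  suffixFrom (step e p) (_ ∷ uniq) (there u∈)  with q , q≤ ← suffixFrom p uniq u∈ =
    q , m≤n⇒m≤1+n q≤

  -- Loop erasure: if the start `u` recurs later on, everything before the recurrence is cut off.
  walk⇒path : ∀ {u v} (p : Walk G u v) → Σ[ q ∈ Path G u v ] pathLength G q ≤ walkLength G p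
  walk⇒path [] = ([] , [] ∷ []) , z≤n
  walk⇒path {u} (step e p)
    with (q , uniq) , q≤ ← walk⇒path p
    with u ∈ˡ? vertices G q
  ... | no u∉  = (step e q , ¬Any⇒All¬ _ u∉ ∷ uniq) , s≤s q≤
  ... | yes u∈ with r , r≤ ← suffixFrom q uniq u∈ = r , m≤n⇒m≤1+n (≤-trans r≤ q≤)

  IsDistance-functional : ∀ {u v a b} → IsDistance G u v a → IsDistance G u v b → a ≡ b
  IsDistance-functional ((p , refl) , a≤) ((q , refl) , b≤) = ≤-antisym (a≤ q) (b≤ p)

  module _ (connected : Connected G) where

    shortestWalk : ∀ u v → ∃[ k ] WalkOfLength u v k × (∀ j → WalkOfLength u v j → k ≤ j)
    shortestWalk u v = least (walkOfLength? u v) _ (proj₁ (connected u v) , refl)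

    dist : Fin n → Fin n → ℕ
    dist u v = proj₁ (shortestWalk u v)

    -- `dist` minimises over walks, `IsDistance` over paths. Every path is a walk, and loop erasure
    -- makes a shortest walk into a path that is no longer, so the minima agree.
    dist-isDistance : ∀ u v → IsDistance G u v (dist u v)
    dist-isDistance u v
      with k , (p , refl) , k≤ ← shortestWalk u v
      with q , q≤ ← walk⇒path p =
      (q , ≤-antisym q≤ (k≤ _ (proj₁ q , refl))) , λ r → k≤ _ (proj₁ r , refl)

    dist-refl : ∀ u → dist u u ≡ 0
    dist-refl u = n≤0⇒n≡0 (proj₂ (proj₂ (shortestWalk u u)) 0 ([] , refl))

    dist≡0⇒≡ : ∀ {u v} → dist u v ≡ 0 → u ≡ v
    dist≡0⇒≡ {u} {v} eq with shortestWalk u v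
    ... | _ , ([] , _) , _            = refl
    ... | _ , (step _ _ , refl) , _ with () ← eq

    dist≡1⇒~ : ∀ {u v} → dist u v ≡ 1 → u ~ v
    dist≡1⇒~ {u} {v} eq with shortestWalk u v
    ... | _ , (step e [] , _) , _              = e
    ... | _ , ([] , refl) , _                with () ← eq
    ... | _ , (step _ (step _ _) , refl) , _ with () ← eq

    ~⇒dist≡1 : ∀ {u v} → u ~ v → dist u v ≡ 1
    ~⇒dist≡1 {u} {v} e = ≤-antisym (proj₂ (proj₂ (shortestWalk u v)) 1 (step e [] , refl))
                                   (positive (dist u v) refl)
      where
      positive : ∀ k → dist u v ≡ k → 1 ≤ k
      positive zero    eq = contradiction e (~-irrefl (dist≡0⇒≡ eq))
      positive (suc _) _  = s≤s z≤n

    -- Resolving sets and the existence of a metric basis.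

    resolves⇒dist≢ : ∀ {r x y} → Resolves G r x y → dist r x ≢ dist r y
    resolves⇒dist≢ (_ , _ , da , db , a≢b) eq =
      a≢b (trans (IsDistance-functional da (dist-isDistance _ _))
                 (trans eq (IsDistance-functional (dist-isDistance _ _) db)))

    dist≢⇒resolves : ∀ {r x y} → dist r x ≢ dist r y → Resolves G r x y
    dist≢⇒resolves neq = _ , _ , dist-isDistance _ _ , dist-isDistance _ _ , neq

    Unresolved : Subset n → Fin n → Fin n → Set
    Unresolved S a b = a ≢ b × (∀ r → r ∈ S → dist r a ≡ dist r b)

    -- A finite search in which failure comes with an explicit pair; the exchange argument works
    -- with that pair.
    resolving-or-unresolved : ∀ S → IsResolvingSet G S ⊎ (∃[ a ] ∃[ b ] Unresolved S a b)
    resolving-or-unresolved S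
      with any? (λ a → any? λ b → ¬? (a ≟ b) ×-dec
                   all? λ r → (r ∈? S) →-dec (dist r a ≟ⁿ dist r b))
    ... | yes unresolved = inj₂ unresolved
    ... | no ¬unresolved = inj₁ resolving
      where
      resolving : IsResolvingSet G S
      resolving x y x≢y with any? (λ r → (r ∈? S) ×-dec ¬? (dist r x ≟ⁿ dist r y))
      ... | yes (r , r∈S , neq) = r , r∈S , dist≢⇒resolves neq
      ... | no ¬∃ = contradiction
        (x , y , x≢y , λ r r∈S → decidable-stable (_ ≟ⁿ _) λ neq → ¬∃ (r , r∈S , neq))
        ¬unresolved

    resolving? : Decidable (IsResolvingSet G)
    resolving? S with resolving-or-unresolved S
    ... | inj₁ resolving = yes resolving
    ... | inj₂ (a , b , a≢b , same) = no λ resolving →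
      let (r , r∈S , res) = resolving a b a≢b in resolves⇒dist≢ res (same r r∈S)

    ⊤-resolving : IsResolvingSet G ⊤
    ⊤-resolving x y x≢y = x , ∈⊤ , dist≢⇒resolves λ eq →
      x≢y (dist≡0⇒≡ (trans (sym eq) (dist-refl x)))

    -- Descent from the full vertex set: while a strictly smaller resolving set exists, pass to it.
    -- A single basis is enough for the count, since it contains every forced vertex.
    metricBasis : ∃ (IsMetricBasis G)
    metricBasis = shrink ⊤ ⊤-resolving (<-wellFounded _)
      where
      shrink : ∀ R → IsResolvingSet G R → Acc _<_ ∣ R ∣ → ∃ (IsMetricBasis G)
      shrink R res (acc rec) with anySubset? (λ S → resolving? S ×-dec (∣ S ∣ <ⁿ? ∣ R ∣))
      ... | yes (S , resS , S<R) = shrink S resS (rec S<R)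
      ... | no ¬smaller = R , res , (R , res , refl) , λ S resS →
              ≮⇒≥ λ S<R → ¬smaller (S , resS , S<R)

    -- Exchanging a forced vertex of a basis.

    module _ {R : Subset n} (basis : IsMetricBasis G R) where

      private
        R-resolving : IsResolvingSet G R
        R-resolving = proj₁ basis

        R-minimum : ∀ S → IsResolvingSet G S → ∣ R ∣ ≤ ∣ S ∣
        R-minimum = proj₂ (proj₂ basis)

      resolving⇒basis : ∀ {S} → IsResolvingSet G S → ∣ S ∣ ≤ ∣ R ∣ → IsMetricBasis G S
      resolving⇒basis {S} res S≤R =
        res , (S , res , refl) , λ T resT → ≤-trans S≤R (R-minimum T resT)

      module _ {v : Fin n} (forced : IsBasisForced G v) where

        private
          v∈R : v ∈ R
          v∈R = forced R basis

        ∉R⇒≢v : ∀ {w} → w ∉ R → w ≢ v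
        ∉R⇒≢v w∉R refl = w∉R v∈R

        -- Equality of the distance vectors with respect to `R` without `v`. Its symmetry and
        -- transitivity link the pairs produced by successive exchanges.
        Same : Fin n → Fin n → Set
        Same a b = ∀ r → r ∈ R → r ≢ v → dist r a ≡ dist r b

        Same-sym : ∀ {a b} → Same a b → Same b a
        Same-sym s r r∈R r≢v = sym (s r r∈R r≢v)

        Same-trans : ∀ {a b c} → Same a b → Same b c → Same a c
        Same-trans s t r r∈R r≢v = trans (s r r∈R r≢v) (t r r∈R r≢v)

        -- Otherwise `a` itself would tell the two apart, being at distance 0 from `a` only.
        Same⇒∉R : ∀ {a b} → Same a b → a ≢ b → a ≢ v → a ∉ R
        Same⇒∉R {a} s a≢b a≢v a∈R =
          a≢b (dist≡0⇒≡ (trans (sym (s a a∈R a≢v)) (dist-refl a)))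

        -- `R` resolves the pair and none of its other vertices does, so `v` must.
        Same⇒separated-by-v : ∀ {a b} → Same a b → a ≢ b → dist v a ≢ dist v b
        Same⇒separated-by-v {a} {b} s a≢b eq
          with r , r∈R , res ← R-resolving a b a≢b
          with r ≟ v
        ... | yes refl = resolves⇒dist≢ res eq
        ... | no r≢v   = resolves⇒dist≢ res (s r r∈R r≢v)

        -- The pair {a , b} is not resolved by (R ∖ {v}) ∪ {u}.
        record Pair (u a b : Fin n) : Set where
          constructor mkPair
          field
            distinct  : a ≢ b
            same      : Same a b
            equidist  : dist u a ≡ dist u b
            left≢     : a ≢ u
            right≢    : b ≢ u

        Pair-sym : ∀ {u a b} → Pair u a b → Pair u b a
        Pair-sym (mkPair d s e l r) = mkPair (≢-sym d) (Same-sym s) (sym e) r l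

        -- If the exchanged set resolved `G`, it would be a metric basis that omits `v`, which is
        -- forced. The vertex `u` may already lie in `R`; hence only an inequality between the
        -- sizes.
        exchange-fails : ∀ {u} → u ≢ v → ∃[ a ] ∃[ b ] Pair u a b
        exchange-fails {u} u≢v with resolving-or-unresolved ((R - v) ∪ ⁅ u ⁆)
        ... | inj₁ res = contradiction (forced _ (resolving⇒basis res size)) v∉
          where
          size : ∣ (R - v) ∪ ⁅ u ⁆ ∣ ≤ ∣ R ∣
          size = begin
            ∣ (R - v) ∪ ⁅ u ⁆ ∣    ≤⟨ ∣p∪q∣≤∣p∣+∣q∣ (R - v) ⁅ u ⁆ ⟩
            ∣ R - v ∣ + ∣ ⁅ u ⁆ ∣  ≡⟨ cong (∣ R - v ∣ +_) (∣⁅x⁆∣≡1 u) ⟩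
            ∣ R - v ∣ + 1          ≡⟨ +-comm ∣ R - v ∣ 1 ⟩
            suc ∣ R - v ∣          ≤⟨ x∈p⇒∣p-x∣<∣p∣ v∈R ⟩
            ∣ R ∣                  ∎
            where open ≤-Reasoning

          v∉ : v ∉ (R - v) ∪ ⁅ u ⁆
          v∉ v∈ with x∈p∪q⁻ (R - v) ⁅ u ⁆ v∈
          ... | inj₁ v∈R-v = x∉p-x R v v∈R-v
            where
            x∉p-x : ∀ {m} (p : Subset m) x → x ∉ p - x
            x∉p-x (inside  ∷ p) zero    ()
            x∉p-x (outside ∷ p) zero    ()
            x∉p-x (_ ∷ p)       (suc x) (there x∈) = x∉p-x p x x∈
          ... | inj₂ v∈⁅u⁆ = u≢v (sym (x∈⁅y⁆⇒x≡y u v∈⁅u⁆))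
        ... | inj₂ (a , b , a≢b , agree) = a , b , record
          { distinct = a≢b
          ; same     = λ r r∈R r≢v → agree r (p⊆p∪q ⁅ u ⁆ (x∈p∧x≢y⇒x∈p-y r∈R r≢v))
          ; equidist = eq
          -- If `a` were `u`, the common distance would be 0 and `b` would be `u` as well.
          ; left≢    = λ where refl → a≢b (dist≡0⇒≡ (trans (sym eq) (dist-refl a)))
          ; right≢   = λ where refl → a≢b (sym (dist≡0⇒≡ (trans eq (dist-refl b))))
          }
          where
          eq : dist u a ≡ dist u b
          eq = agree u (q⊆p∪q (R - v) ⁅ u ⁆ (x∈⁅x⁆ u))

        -- Non-neighbours of a forced vertex outside the basis.

        equidistant-~ : ∀ {u a b} → dist u a ≡ dist u b → u ~ a → u ~ b
        equidistant-~ eq u~a = dist≡1⇒~ (trans (sym eq) (~⇒dist≡1 u~a))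

        -- If `v` is adjacent to everything outside `R`, two distinct `Same` vertices other than `v`
        -- are both at distance 1 from `v`, which is impossible. So every unresolved pair contains
        -- `v`. Exchanging `v` for its partner `y` gives a second partner `w`, and `y` and `w` form
        -- such an impossible pair.
        nonneighbour∉R : ∀ {u} → u ≢ v → ¬ (∀ w → w ∉ R → v ~ w)
        nonneighbour∉R u≢v adjacent = refute (throughV (exchange-fails u≢v))
          where
          impossible : ∀ {a b} → Same a b → a ≢ b → a ≢ v → b ≢ v → ⊥
          impossible s a≢b a≢v b≢v = Same⇒separated-by-v s a≢b
            (trans (~⇒dist≡1 (adjacent _ (Same⇒∉R s a≢b a≢v)))
                   (sym (~⇒dist≡1 (adjacent _ (Same⇒∉R (Same-sym s) (≢-sym a≢b) b≢v)))))

          throughV : ∀ {u} → (∃[ a ] ∃[ b ] Pair u a b) → ∃[ b ] Pair u v b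
          throughV (a , b , p) with a ≟ v | b ≟ v
          ... | yes refl | _        = b , p
          ... | no _     | yes refl = a , Pair-sym p
          ... | no a≢v   | no b≢v   = contradiction b≢v
                (impossible (Pair.same p) (Pair.distinct p) a≢v)

          refute : ∀ {u} → ¬ (∃[ b ] Pair u v b)
          refute (y , p) with w , q ← throughV (exchange-fails (≢-sym (Pair.distinct p))) =
            impossible (Same-trans (Same-sym (Pair.same p)) (Pair.same q))
              (≢-sym (Pair.right≢ q)) (≢-sym (Pair.distinct p)) (≢-sym (Pair.distinct q))

        -- With `x` as the only exception to adjacency, every unresolved pair contains `v` or `x`.
        -- Exchange `v` for `x`, then for the partner `z` found, then for the next partner `y`. Each
        -- branch ends in two distinct `Same` vertices avoiding both `v` and `x`, in an adjacency
        -- already excluded, or in a pair containing the exchanged vertex.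
        second-nonneighbour∉R : ∀ {x} → x ∉ R → ¬ (v ~ x) →
                                ¬ (∀ w → w ∉ R → w ≢ x → v ~ w)
        second-nonneighbour∉R {x} x∉R v≁x adjacent = refute (classify (∉R⇒≢v x∉R))
          where
          through-x : ∀ {a b} → Same a b → a ≢ b → a ≢ v → b ≢ v → a ≡ x ⊎ b ≡ x
          through-x {a} {b} s a≢b a≢v b≢v with a ≟ x | b ≟ x
          ... | yes a≡x | _       = inj₁ a≡x
          ... | no _    | yes b≡x = inj₂ b≡x
          ... | no a≢x  | no b≢x  = contradiction
                (trans (~⇒dist≡1 (adjacent _ (Same⇒∉R s a≢b a≢v) a≢x))
                       (sym (~⇒dist≡1
                         (adjacent _ (Same⇒∉R (Same-sym s) (≢-sym a≢b) b≢v) b≢x))))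
                (Same⇒separated-by-v s a≢b)

          ¬Same-off-x : ∀ {a b} → a ≢ b → a ≢ v → b ≢ v → a ≢ x → b ≢ x → ¬ Same a b
          ¬Same-off-x a≢b a≢v b≢v a≢x b≢x s = [ a≢x , b≢x ]′ (through-x s a≢b a≢v b≢v)

          classify : ∀ {u} → u ≢ v → ∃[ b ] (Pair u v b ⊎ (Pair u x b × b ≢ v))
          classify u≢v
            with a , b , p ← exchange-fails u≢v
            with a ≟ v | b ≟ v
          ... | yes refl | _        = b , inj₁ p
          ... | no _     | yes refl = a , inj₁ (Pair-sym p)
          ... | no a≢v   | no b≢v with through-x (Pair.same p) (Pair.distinct p) a≢v b≢v
          ...   | inj₁ refl = b , inj₂ (p , b≢v)
          ...   | inj₂ refl = a , inj₂ (Pair-sym p , a≢v)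

          refute : ¬ (∃[ z ] (Pair x v z ⊎ (Pair x x z × z ≢ v)))
          refute (z , inj₂ (p , _)) = Pair.left≢ p refl
          -- Here `z` is a neighbour of `v` but not of `x`, since `x` is equidistant from `z` and
          -- its non-neighbour `v`. The next exchange is for `z`.
          refute (z , inj₁ (mkPair v≢z v≈z xv≡xz _ z≢x)) = refute-z (classify z≢v)
            where
            z≢v : z ≢ v
            z≢v = ≢-sym v≢z

            z~v : z ~ v
            z~v = ~-sym (adjacent z (Same⇒∉R (Same-sym v≈z) z≢v z≢v) z≢x)

            z≁x : ¬ (z ~ x)
            z≁x z~x = v≁x (~-sym (equidistant-~ (sym xv≡xz) (~-sym z~x)))

            refute-z : ¬ (∃[ y ] (Pair z v y ⊎ (Pair z x y × y ≢ v)))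
            -- If `y` is `x`, equidistance from `z` carries `z ~ v` over to `z ~ x`. Otherwise `y`
            -- and `z` are both `Same` as `v` and avoid `x`.
            refute-z (y , inj₁ (mkPair v≢y v≈y zv≡zy _ y≢z)) with y ≟ x
            ... | yes refl = z≁x (equidistant-~ zv≡zy z~v)
            ... | no y≢x   = ¬Same-off-x y≢z (≢-sym v≢y) z≢v y≢x z≢x
                               (Same-trans (Same-sym v≈y) v≈z)
            -- The surviving branch: `y` is a neighbour of `v` but, by equidistance from `z`, not of
            -- `z`. The last exchange is for `y`.
            refute-z (y , inj₂ (mkPair x≢y x≈y zx≡zy _ y≢z , y≢v)) = refute-y (classify y≢v)
              where
              y≢x : y ≢ x
              y≢x = ≢-sym x≢y

              y~v : y ~ v
              y~v = ~-sym (adjacent y (Same⇒∉R (Same-sym x≈y) y≢x y≢v) y≢x)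

              y≁z : ¬ (y ~ z)
              y≁z y~z = z≁x (equidistant-~ (sym zx≡zy) (~-sym y~z))

              refute-y : ¬ (∃[ w ] (Pair y v w ⊎ (Pair y x w × w ≢ v)))
              refute-y (w , inj₂ (mkPair x≢w x≈w _ _ w≢y , w≢v)) =
                ¬Same-off-x w≢y w≢v y≢v (≢-sym x≢w) y≢x (Same-trans (Same-sym x≈w) x≈y)
              -- If `w` is `z`, then `y ~ v` gives `y ~ z`. If `w` is `x`, the classes of `x` and
              -- `v` merge, making `y` and `z` `Same`. Otherwise `w` and `z` are `Same` through `v`.
              refute-y (w , inj₁ (mkPair v≢w v≈w yv≡yw _ w≢y)) with w ≟ z | w ≟ x
              ... | yes refl | _        = y≁z (equidistant-~ yv≡yw y~v)
              ... | no _     | yes refl = ¬Same-off-x y≢z y≢v z≢v y≢x z≢x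
                    (Same-trans (Same-sym x≈y) (Same-trans (Same-sym v≈w) v≈z))
              ... | no w≢z   | no w≢x   = ¬Same-off-x w≢z (≢-sym v≢w) z≢v w≢x z≢x
                    (Same-trans (Same-sym v≈w) v≈z)

        -- Two successive finite searches; if either fails, decidability of adjacency turns the
        -- failure into the hypothesis refuted above. The vertex `u` is where the first exchange
        -- starts.
        two-nonneighbours : ∀ {u} → u ≢ v →
          ∃[ x ] ∃[ y ] x ≢ y × (x ∉ R × ¬ (v ~ x)) × (y ∉ R × ¬ (v ~ y))
        two-nonneighbours u≢v with any? (λ x → ¬? (x ∈? R) ×-dec ¬? (v ~? x))
        ... | no ¬∃ = contradiction
              (λ w w∉R → decidable-stable (v ~? w) λ v≁w → ¬∃ (w , w∉R , v≁w))
              (nonneighbour∉R u≢v)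
        ... | yes (x , x∉R , v≁x)
          with any? (λ y → ¬? (x ≟ y) ×-dec (¬? (y ∈? R) ×-dec ¬? (v ~? y)))
        ...   | yes (y , x≢y , y∉) = x , y , x≢y , (x∉R , v≁x) , y∉
        ...   | no ¬∃ = contradiction
                (λ w w∉R w≢x → decidable-stable (v ~? w) λ v≁w →
                   ¬∃ (w , ≢-sym w≢x , w∉R , v≁w))
                (second-nonneighbour∉R x∉R v≁x)

      -- Counting edges together with the chosen non-edges.

      module _ (other : (v : Fin n) → Σ[ u ∈ Fin n ] u ≢ v)
               (F : Subset n) (forced : {v : Fin n} → v ∈ F → IsBasisForced G v) where

        private
          chosen : ∀ v → ∃[ x ] ∃[ y ] (v ∈ F →
                     x ≢ y × (x ∉ R × ¬ (v ~ x)) × (y ∉ R × ¬ (v ~ y)))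
          chosen v with v ∈? F
          -- A dummy value that keeps the choice total; the lists below run over `elements F` only,
          -- so it never enters them.
          ... | no v∉F  = v , v , λ v∈F → contradiction v∈F v∉F
          ... | yes v∈F with x , y , props ← two-nonneighbours (forced v∈F) (proj₂ (other v)) =
            x , y , λ _ → props

          x₁ x₂ : Fin n → Fin n
          x₁ v = proj₁ (chosen v)
          x₂ v = proj₁ (proj₂ (chosen v))

        nonedges₁ nonedges₂ : List (Fin n × Fin n)
        nonedges₁ = map (λ v → v , x₁ v) (elements F)
        nonedges₂ = map (λ v → v , x₂ v) (elements F)

        -- Edges are oriented upwards, the chosen non-edges from R to its complement.
        Oriented : Fin n → Fin n → Set
        Oriented i j = (i <ᶠ j × i ~ j) ⊎ ((i ∈ R × j ∉ R) × ¬ (i ~ j))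

        -- An edge and a non-edge clash by symmetry of `~`; a reversed non-edge would start outside
        -- `R`. Hence two forced vertices never share a chosen non-edge.
        Oriented-asym : ∀ i j → Oriented i j → ¬ Oriented j i
        Oriented-asym i j (inj₁ (i<j , _))       (inj₁ (j<i , _))       = <ᶠ-asym i<j j<i
        Oriented-asym i j (inj₁ (_ , i~j))       (inj₂ (_ , j≁i))       = j≁i (~-sym i~j)
        Oriented-asym i j (inj₂ (_ , i≁j))       (inj₁ (_ , j~i))       = i≁j (~-sym j~i)
        Oriented-asym i j (inj₂ ((i∈R , _) , _)) (inj₂ ((_ , i∉R) , _)) = i∉R i∈R

        edges-~ : ∀ {i j} → (i , j) ∈ˡ edges G → i <ᶠ j × i ~ j
        edges-~ e∈ = proj₂ (∈-filter⁻ _ {xs = cartesianProduct (allFin n) (allFin n)} e∈)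

        nonedges-≁ : ∀ {i j} → (i , j) ∈ˡ nonedges₁ ++ nonedges₂ → (i ∈ R × j ∉ R) × ¬ (i ~ j)
        nonedges-≁ e∈ with ∈-++⁻ nonedges₁ e∈
        ... | inj₁ e∈₁ with v , v∈ , refl ← ∈-map⁻ _ e∈₁
          with v∈F ← ∈-elements⁻ F v∈
          with _ , (x∉ , v≁x) , _ ← proj₂ (proj₂ (chosen v)) v∈F = (forced v∈F R basis , x∉) , v≁x
        ... | inj₂ e∈₂ with v , v∈ , refl ← ∈-map⁻ _ e∈₂
          with v∈F ← ∈-elements⁻ F v∈
          with _ , _ , (y∉ , v≁y) ← proj₂ (proj₂ (chosen v)) v∈F = (forced v∈F R basis , y∉) , v≁y

        -- First entries are distinct within each list. Across the lists, equal first entries mean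
        -- the same `v`, whose two chosen non-neighbours differ.
        nonedges-unique : Unique (nonedges₁ ++ nonedges₂)
        nonedges-unique = Unique.++⁺ (Unique.map⁺ (cong proj₁) (elements-unique F))
                                     (Unique.map⁺ (cong proj₁) (elements-unique F)) disjoint
          where
          disjoint : ∀ {e} → ¬ (e ∈ˡ nonedges₁ × e ∈ˡ nonedges₂)
          disjoint (e∈₁ , e∈₂)
            with v , v∈ , refl ← ∈-map⁻ _ e∈₁
            with _ , _ , eq ← ∈-map⁻ _ e∈₂
            with refl ← cong proj₁ eq =
            proj₁ (proj₂ (proj₂ (chosen v)) (∈-elements⁻ F v∈)) (cong proj₂ eq)

        edges-unique : Unique (edges G)
        edges-unique =
          Unique.filter⁺ _ (Unique.cartesianProduct⁺ (Unique.allFin⁺ n) (Unique.allFin⁺ n))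

        pairs : List (Fin n × Fin n)
        pairs = edges G ++ (nonedges₁ ++ nonedges₂)

        pairs-oriented : ∀ {i j} → (i , j) ∈ˡ pairs → Oriented i j
        pairs-oriented e∈ with ∈-++⁻ (edges G) e∈
        ... | inj₁ e∈₁ = inj₁ (edges-~ e∈₁)
        ... | inj₂ e∈₂ = inj₂ (nonedges-≁ e∈₂)

        pairs-unique : Unique pairs
        pairs-unique = Unique.++⁺ edges-unique nonedges-unique λ (e∈₁ , e∈₂) →
          proj₂ (nonedges-≁ e∈₂) (proj₂ (edges-~ e∈₁))

        length-pairs : length pairs ≡ ∣E∣ G + 2 * ∣ F ∣
        length-pairs = trans (length-++ (edges G)) (cong (∣E∣ G +_)
          (trans (length-++ nonedges₁)
            (cong₂ _+_ (trans (length-map _ (elements F)) (length-elements F))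
                       (trans (length-map _ (elements F))
                              -- `2 * m` unfolds to `m + (m + 0)`, whence the trailing zero.
                              (trans (length-elements F) (sym (+-identityʳ ∣ F ∣)))))))

        double-count : (∣E∣ G + 2 * ∣ F ∣) + (∣E∣ G + 2 * ∣ F ∣) + n ≤ n * n
        double-count = subst (λ m → m + m + n ≤ n * n) length-pairs
          (asymmetric-pairs-length Oriented-asym pairs pairs-unique pairs-oriented)

-- From the count of ordered pairs to the bound.

-- Cancelling `n` leaves twice `m` at most `n * (n ∸ 1)`, and halving is monotone. The split on `n`
-- lets the truncated subtraction reduce.
m+m+n≤n*n⇒m≤n*[n∸1]/2 : ∀ m n → m + m + n ≤ n * n → m ≤ n * (n ∸ 1) / 2
m+m+n≤n*n⇒m≤n*[n∸1]/2 zero zero    _ = z≤n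
m+m+n≤n*n⇒m≤n*[n∸1]/2 m (suc n) h = begin
  m                  ≡⟨ m*n/n≡m m 2 ⟨
  m * 2 / 2          ≤⟨ /-monoˡ-≤ 2 m*2≤ ⟩
  suc n * n / 2      ∎
  where
  open ≤-Reasoning
  m*2≤ : m * 2 ≤ suc n * n
  m*2≤ = +-cancelˡ-≤ (suc n) _ _ (begin
    suc n + m * 2        ≡⟨ cong (suc n +_) (*-comm m 2) ⟩
    suc n + (m + (m + 0)) ≡⟨ cong (λ k → suc n + (m + k)) (+-identityʳ m) ⟩
    suc n + (m + m)      ≡⟨ +-comm (suc n) (m + m) ⟩
    m + m + suc n        ≤⟨ h ⟩
    suc n * suc n        ≡⟨ *-suc (suc n) n ⟩
    suc n + suc n * n    ∎)

other-vertex : n ≥ 3 → (v : Fin n) → ∃[ u ] u ≢ v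
other-vertex (s≤s (s≤s _)) zero    = suc zero , λ ()
other-vertex (s≤s (s≤s _)) (suc v) = zero , λ ()

theorem9 : ∀ (n : ℕ) (G : Graph n) → n ≥ 3 → Connected G →
    ∀ (k : ℕ) → k > 0 → HasBasisForcedVertices G k →
    ∣E∣ G + 2 * k ≤ n * (n ∸ 1) / 2
theorem9 n G n≥3 connected k _ (F , F⇔forced , refl) =
  m+m+n≤n*n⇒m≤n*[n∸1]/2 _ n
    (double-count G connected (proj₂ (metricBasis G connected)) (other-vertex n≥3) F
      (λ {v} → Equivalence.to (F⇔forced v)))
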